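{- Let $G=(V,E)$ be a directed graph with $V=\{1,\dots,N\}$ and $E\subseteq V^2$ (self-loops allowed), with labeled adjacency matrix $\mathsf W$, and let $\mathcal S$ be the set of all non-empty subsets of $V$ (including $V$). Let $\mathsf P_{\mathrm{op}}(z)$ and $\mathsf P_{\mathrm{cl}}(z)$ be the matrix generating series of the open simple paths and of the closed simple paths (simple cycles) of $G$, respectively. Then: (i) $$\mathsf P_{\mathrm{op}}(z)=\sum_{S\in\mathcal S}(z\mathsf W_S)^{|S|-1}(\mathsf I-z\mathsf W_S)^{N-|S|};$$ (ii) $$\mathsf P_{\mathrm{cl}}(z)=\sum_{S\in\mathcal S}\operatorname{Diag}\Big((z\mathsf W_S)^{|S|}(\mathsf I-z\mathsf W_S)^{N-|S|}\Big).$$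
   Context: Each arc $(i,j)\in E$ carries a label $\omega_{ij}$. The labeled adjacency matrix $\mathsf W$ is the $N\times N$ matrix with $\mathsf W_{ij}=\omega_{ij}$ if $(i,j)\in E$ and $\mathsf W_{ij}=0$ otherwise. $\mathsf I$ is the $N\times N$ identity matrix and $z$ is a formal variable. A path $p$ of length $\ell(p)=\ell\ge 1$ from $i$ to $j$ is a sequence of $\ell$ contiguous arcs (each new arc starts where the previous one ended), written $p=\omega_{ii_1}\omega_{i_1i_2}\cdots\omega_{i_{\ell-1}j}$. A path is open if its end vertices $i,j$ are different and closed (a cycle) otherwise. By convention, the empty path $1$ is considered a cycle of zero length. $V(p)$ is the set of vertices of $p$ and $|V(p)|$ its size. Simple paths are paths that do not visit the same vertex more than once (the start and end vertices of a closed path coinciding); they are characterized as the non-empty paths $p$ such that $\ell(p)=|V(p)|-1$ if $p$ is open and $\ell(p)=|V(p)|$ if $p$ is closed. In particular self-loops $\omega_{ii}$ and backtracks $\omega_{ij}\omega_{ji}$ are cycles of length $1$ and $2$. $\mathsf P(z)$ is the $N\times N$ matrix with entries $\mathsf P_{ij}(z)=\sum_{p:\,i\to j,\ p\text{ simple}}p\,z^{\ell(p)}$. For a square matrix $\mathsf M$, $\operatorname{Diag}(\mathsf M)$ is the diagonal matrix obtained by setting all off-diagonal entries of $\mathsf M$ to zero. Set $\mathsf P_{\mathrm{cl}}(z)=\operatorname{Diag}(\mathsf P(z))$ and $\mathsf P_{\mathrm{op}}(z)=\mathsf P(z)-\mathsf P_{\mathrm{cl}}(z)$. For an $N\times N$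 matrix $\mathsf M$ and $S\in\mathcal S$, $\mathsf M_S$ is the $N\times N$ matrix with $(\mathsf M_S)_{ij}=\mathsf M_{ij}$ if $i,j\in S$ and $0$ otherwise.
   Formalization: Identity (i) is false as printed on the diagonal: each singleton S contributes the identity at z^0 (for N = 1 the right side is 1, but P_op = 0); the formal version subtracts N·I from the right side of (i), leaving off-diagonal entries unchanged. -}

module Defs where

open import Algebra.Bundles using (Ring)
open import Algebra.Bundles.Raw using (RawRing)
import Algebra.Definitions.RawSemiring as RawSemiringDefs
open import Data.Bool.Base using (if_then_else_; _∧_)
open import Data.Fin.Base using (Fin; toℕ)
open import Data.Fin.Properties using (_≟_)
open import Data.Fin.Subset using (Subset; Side; inside; outside; ⊥; ⁅_⁆; _∪_; ∣_∣; Nonempty)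
open import Data.Fin.Subset.Properties using (_∈?_; nonempty?)
open import Data.List.Base using (List; []; _∷_; map; foldr; filter; allFin; cartesianProduct; cartesianProductWith)
open import Data.List.Membership.Propositional using (_∈_)
open import Data.List.Membership.Propositional.Properties
  using (∈-cartesianProduct⁺; ∈-cartesianProductWith⁺; ∈-allFin; ∈-filter⁺; ∈-filter⁻)
open import Data.List.Relation.Unary.All using ([]; _∷_)
open import Data.List.Relation.Unary.Any using (here; there)
open import Data.List.Relation.Unary.Unique.Propositional using (Unique; []; _∷_)
open import Data.List.Relation.Unary.Unique.Propositional.Properties
  using (cartesianProduct⁺; cartesianProductWith⁺; allFin⁺; filter⁺)
open import Data.Nat.Base as ℕ using (ℕ; zero; suc; _∸_)
import Data.Nat.Properties as ℕ
open import Data.Product.Base using (_×_; _,_; proj₂)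
open import Data.Sum.Base using (_⊎_)
open import Data.Vec.Base as Vec using (Vec; []; _∷_)
open import Data.Vec.Properties using (∷-injective)
open import Function.Bundles using (_⇔_; mk⇔)
open import Level using (Level; _⊔_) renaming (suc to lsuc)
open import Relation.Binary.Core using (Rel)
open import Relation.Binary.Definitions using (Decidable)
open import Relation.Binary.PropositionalEquality using (_≡_; _≢_; refl)
open import Relation.Nullary.Decidable using (Dec; yes; no; does; ¬?; _×-dec_; _⊎-dec_)

private
  variable
    a c ℓ e : Level
    A : Set a
    n : ℕ

-- K[[z]], a series being its sequence of coefficients; z is central.
seriesRawRing : RawRing c ℓ → RawRing c ℓ
seriesRawRing K = record
  { Carrier = ℕ → Carrier
  ; _≈_     = λ f g → ∀ d → f d ≈ g d
  ; _+_     = λ f g d → f d + g d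
  ; _*_     = λ f g d → sum {suc d} λ k → f (toℕ k) * g (d ∸ toℕ k)
  ; -_      = λ f d → - f d
  ; 0#      = λ _ → 0#
  ; 1#      = λ { zero → 1# ; (suc _) → 0# }
  }
  where
  open RawRing K
  open RawSemiringDefs rawSemiring using (sum)

matrixRawRing : RawRing c ℓ → ℕ → RawRing c ℓ
matrixRawRing K n = record
  { Carrier = Fin n → Fin n → Carrier
  ; _≈_     = λ M M′ → ∀ i j → M i j ≈ M′ i j
  ; _+_     = λ M M′ i j → M i j + M′ i j
  ; _*_     = λ M M′ i j → sum λ k → M i k * M′ k j
  ; -_      = λ M i j → - M i j
  ; 0#      = λ _ _ → 0#
  ; 1#      = λ i j → if does (i ≟ j) then 1# else 0#
  }
  where
  open RawRing K
  open RawSemiringDefs rawSemiring using (sum)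

module _ (K : RawRing c ℓ) where
  open RawRing K

  constant : Carrier → ℕ → Carrier
  constant x zero      = x
  constant x (suc _) = 0#

  indeterminate : ℕ → Carrier
  indeterminate 1 = 1#
  indeterminate _ = 0#

  diagonal : (Fin n → Fin n → Carrier) → Fin n → Fin n → Carrier
  diagonal M i j = if does (i ≟ j) then M i j else 0#

  restrict : (Fin n → Fin n → Carrier) → Subset n → Fin n → Fin n → Carrier
  restrict M S i j = if does (i ∈? S) ∧ does (j ∈? S) then M i j else 0#

vectors : List A → ∀ n → List (Vec A n)
vectors xs zero    = [] ∷ []
vectors xs (suc n) = cartesianProductWith _∷_ xs (vectors xs n)

∈-vectors : {xs : List A} → (∀ x → x ∈ xs) → (v : Vec A n) → v ∈ vectors xs n
∈-vectors all []      = here refl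
∈-vectors all (x ∷ v) = ∈-cartesianProductWith⁺ _∷_ (all x) (∈-vectors all v)

vectors-unique : {xs : List A} → Unique xs → ∀ n → Unique (vectors xs n)
vectors-unique u zero      = [] ∷ []
vectors-unique u (suc n) = cartesianProductWith⁺ _∷_ ∷-injective u (vectors-unique u n)

nonemptySubsets : ∀ n → List (Subset n)
nonemptySubsets n = filter nonempty? (vectors (inside ∷ outside ∷ []) n)

nonemptySubsets-unique : ∀ n → Unique (nonemptySubsets n)
nonemptySubsets-unique n =
  filter⁺ nonempty? (vectors-unique (((λ ()) ∷ []) ∷ [] ∷ []) n)

∈-nonemptySubsets : (S : Subset n) → S ∈ nonemptySubsets n ⇔ Nonempty S
∈-nonemptySubsets {n} S = mk⇔
  (λ S∈ → proj₂ (∈-filter⁻ nonempty? {xs = vectors _ n} S∈))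
  (∈-filter⁺ nonempty? (∈-vectors sides S))
  where
  sides : (s : Side) → s ∈ inside ∷ outside ∷ []
  sides inside  = here refl
  sides outside = there (here refl)

-- Only the values of ω on the arcs are ever used.
record LabeledDigraph (L : Set c) (N : ℕ) (e : Level) : Set (c ⊔ lsuc e) where
  field
    E  : Rel (Fin N) e
    E? : Decidable E
    ω  : Fin N → Fin N → L

module Paths {L : Set c} {N : ℕ} (G : LabeledDigraph L N e) where
  open LabeledDigraph G

  Pair : Set
  Pair = Fin N × Fin N

  data IsPath : ∀ {l} → Fin N → Fin N → Vec Pair l → Set e where
    [_] : ∀ {i j} → E i j → IsPath i j ((i , j) ∷ [])
    _∷_ : ∀ {i k j l} {p : Vec Pair l} →
          E i k → IsPath k j p → IsPath i j ((i , k) ∷ p)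

  isPath? : ∀ {l} i j (p : Vec Pair l) → Dec (IsPath i j p)
  isPath? i j [] = no λ ()
  isPath? i j ((i′ , k) ∷ p) with i ≟ i′ | E? i k
  ... | no i≢i′  | _      = no λ { [ _ ] → i≢i′ refl ; (_ ∷ _) → i≢i′ refl }
  ... | yes refl | no ¬ik = no λ { [ ik ] → ¬ik ik ; (ik ∷ _) → ¬ik ik }
  isPath? i j ((_ , k) ∷ []) | yes refl | yes ik with k ≟ j
  ... | yes refl = yes [ ik ]
  ... | no k≢j   = no λ { [ _ ] → k≢j refl ; (_ ∷ ()) }
  isPath? i j ((_ , k) ∷ p@(_ ∷ _)) | yes refl | yes ik with isPath? k j p
  ... | yes kj = yes (ik ∷ kj)
  ... | no ¬kj = no λ { (_ ∷ kj) → ¬kj kj }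

  V : ∀ {l} → Vec Pair l → Subset N
  V []            = ⊥
  V ((i , j) ∷ p) = ⁅ i ⁆ ∪ (⁅ j ⁆ ∪ V p)

  IsSimplePath : ∀ {l} → Fin N → Fin N → Vec Pair l → Set e
  IsSimplePath {l} i j p =
    IsPath i j p × (i ≢ j × l ≡ ∣ V p ∣ ∸ 1 ⊎ i ≡ j × l ≡ ∣ V p ∣)

  isSimplePath? : ∀ {l} i j (p : Vec Pair l) → Dec (IsSimplePath i j p)
  isSimplePath? {l} i j p = isPath? i j p ×-dec
    ((¬? (i ≟ j) ×-dec l ℕ.≟ ∣ V p ∣ ∸ 1) ⊎-dec (i ≟ j ×-dec l ℕ.≟ ∣ V p ∣))

  pairs : List Pair
  pairs = cartesianProduct (allFin N) (allFin N)

  simplePaths : Fin N → Fin N → ∀ l → List (Vec Pair l)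
  simplePaths i j l = filter (isSimplePath? i j) (vectors pairs l)

  simplePaths-unique : ∀ i j l → Unique (simplePaths i j l)
  simplePaths-unique i j l = filter⁺ (isSimplePath? i j)
    (vectors-unique (cartesianProduct⁺ (allFin⁺ N) (allFin⁺ N)) l)

  ∈-simplePaths : ∀ i j {l} (p : Vec Pair l) →
                  p ∈ simplePaths i j l ⇔ IsSimplePath i j p
  ∈-simplePaths i j {l} p = mk⇔
    (λ p∈ → proj₂ (∈-filter⁻ (isSimplePath? i j) {xs = vectors pairs l} p∈))
    (∈-filter⁺ (isSimplePath? i j)
      (∈-vectors (λ (u , v) → ∈-cartesianProduct⁺ (∈-allFin u) (∈-allFin v)) p))

-- The labels live in an arbitrary, possibly noncommutative, ring; taking the
-- free ring on the arcs gives formal, noncommuting labels.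
module GeneratingSeries (R : Ring c ℓ) {N : ℕ}
                        (G : LabeledDigraph (Ring.Carrier R) N e) where
  private module R = Ring R
  open LabeledDigraph G
  open Paths G

  seriesRing : RawRing c ℓ
  seriesRing = seriesRawRing R.rawRing

  matrixRing : RawRing c ℓ
  matrixRing = matrixRawRing seriesRing N

  open RawRing matrixRing public
    using (_≈_; _+_; _*_; -_; 0#)
    renaming (Carrier to Matrix; 1# to I)
  open RawSemiringDefs (RawRing.rawSemiring matrixRing) public
    using (_^_)
    renaming (_×_ to _·_)

  infixl 6 _-_
  _-_ : Matrix → Matrix → Matrix
  M - M′ = M + (- M′)

  Diag : Matrix → Matrix
  Diag = diagonal seriesRing

  W : Fin N → Fin N → R.Carrier
  W i j = if does (E? i j) then ω i j else R.0#

  zW : Subset N → Matrix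
  zW S i j = indeterminate R.rawRing *ₛ constant R.rawRing (restrict R.rawRing W S i j)
    where open RawRing seriesRing using () renaming (_*_ to _*ₛ_)

  weight : ∀ {l} → Vec Pair l → R.Carrier
  weight []            = R.1#
  weight ((i , j) ∷ p) = ω i j R.* weight p

  -- The coefficient of z^l only involves the finitely many paths of length l.
  P : Matrix
  P i j l = foldr R._+_ R.0# (map weight (simplePaths i j l))

  Pcl : Matrix
  Pcl = Diag P

  Pop : Matrix
  Pop = P - Pcl

  ∑𝒮 : (Subset N → Matrix) → Matrix
  ∑𝒮 F = foldr _+_ 0# (map F (nonemptySubsets N))

{-# OPTIONS --safe #-}

-- Expanding the S-summand over walks, a walk p of length l ≥ 1 is counted once
-- for each S ⊇ V p, with coefficient [z^l] z^(|S|-1) (1 - z)^(N-|S|) in (i) and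
-- [z^l] z^|S| (1 - z)^(N-|S|) in (ii).  Since z + (1 - z) = 1, deciding one after
-- the other which vertices outside V p belong to S telescopes these polynomials to
-- z^(|V p|-1) and z^|V p|, so exactly the walks with l = |V p| - 1, resp.
-- l = |V p|, survive.  Closed walks have l ≥ |V p|, so on the diagonal (i) keeps only
-- the constant terms, one I for each singleton S.
module Submission where

open import Algebra.Bundles using (CommutativeMonoid; Ring)
open import Algebra.Bundles.Raw using (RawRing)
import Algebra.Definitions.RawSemiring as RawSemiringDefs
import Algebra.Properties.CommutativeSemigroup as CommutativeSemigroupProperties
import Algebra.Properties.AbelianGroup as AbelianGroupProperties
import Algebra.Properties.Ring as RingProperties
import Algebra.Properties.Semiring.Sum as SemiringSum
open import Data.Bool.Base using (if_then_else_)
open import Data.Empty using (⊥-elim)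
open import Data.Fin.Base using (Fin; zero; suc; toℕ)
open import Data.Fin.Properties using (_≟_)
open import Data.Fin.Subset
  using (Subset; inside; outside; ⊥; ⊤; ⁅_⁆; _∪_; ∣_∣; Nonempty; _∈_; _⊆_)
open import Data.Fin.Subset.Properties
  using (_∈?_; nonempty?; ∈⊤; ∣⊥∣≡0; ∣⁅x⁆∣≡1; ∣p∣≤n; ∣p∣≤∣x∷p∣; p⊆q⇒∣p∣≤∣q∣;
         drop-∷-⊆; ∉⊥; x∈⁅x⁆; x∈⁅y⁆⇒x≡y; x∈p∪q⁺; x∈p∪q⁻; Empty-unique)
open import Data.List.Base
  using (List; []; _∷_; _++_; map; foldr; filter; tabulate; allFin; cartesianProductWith)
open import Data.Nat.Base as ℕ using (ℕ; zero; suc; _∸_; _≤_; _<_; z≤n; s≤s)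
import Data.Nat.Properties as ℕ
open import Data.Product.Base using (_×_; _,_; proj₁; proj₂)
open import Data.Sum.Base using (inj₁; inj₂)
open import Data.Vec.Base using (Vec; []; _∷_; here; there)
open import Function.Base using (_∘_; id)
open import Level using (Level)
open import Relation.Binary.PropositionalEquality as ≡ using (_≡_; _≢_)
open import Relation.Nullary using (¬_; Dec; yes; no; does; contradiction)
open import Relation.Unary using (Pred; Decidable)

open import Defs

private
  variable
    a b p : Level
    A : Set a
    B : Set b
    n : ℕ

-- Cardinalities of subsets.

nonempty⇒∣p∣>0 : {S : Subset n} → Nonempty S → 0 < ∣ S ∣
nonempty⇒∣p∣>0 (_ , here) = s≤s z≤n
nonempty⇒∣p∣>0 {S = s ∷ S} (_ , there i∈S) =
  ℕ.≤-trans (nonempty⇒∣p∣>0 (_ , i∈S)) (∣p∣≤∣x∷p∣ s S)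

∣p∪q∣≤∣p∣+∣q∣ : (S T : Subset n) → ∣ S ∪ T ∣ ≤ ∣ S ∣ ℕ.+ ∣ T ∣
∣p∪q∣≤∣p∣+∣q∣ []            []            = z≤n
∣p∪q∣≤∣p∣+∣q∣ (outside ∷ S) (outside ∷ T) = ∣p∪q∣≤∣p∣+∣q∣ S T
∣p∪q∣≤∣p∣+∣q∣ (outside ∷ S) (inside  ∷ T) =
  ℕ.≤-trans (s≤s (∣p∪q∣≤∣p∣+∣q∣ S T)) (ℕ.≤-reflexive (≡.sym (ℕ.+-suc ∣ S ∣ ∣ T ∣)))
∣p∪q∣≤∣p∣+∣q∣ (inside  ∷ S) (t       ∷ T) =
  s≤s (ℕ.≤-trans (∣p∪q∣≤∣p∣+∣q∣ S T) (ℕ.+-monoʳ-≤ ∣ S ∣ (∣p∣≤∣x∷p∣ t T)))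

-- Finite sums over a possibly noncommutative ring.

module RingSums {c ℓ} (R : Ring c ℓ) where
  open Ring R hiding (zero)
  open RingProperties R using (x[y-z]≈xy-xz)
  open SemiringSum semiring public
  open import Algebra.Properties.Monoid.Mult +-monoid using () renaming (_×_ to _⊠_)
  open CommutativeSemigroupProperties
    (CommutativeMonoid.commutativeSemigroup +-commutativeMonoid) using (interchange)
  open AbelianGroupProperties +-abelianGroup using (⁻¹-∙-comm; ε⁻¹≈ε; //-rightDividesˡ)
  open import Relation.Binary.Reasoning.Setoid setoid

  -- What is needed to carry a map through a finite sum; the instances are left multiplication,
  -- negation and `coeff r s d`.
  record IsAdditive (h : Carrier → Carrier) : Set (c Level.⊔ ℓ) where
    field
      h-cong : ∀ {x y} → x ≈ y → h x ≈ h y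
      h-0    : h 0# ≈ 0#
      h-+    : ∀ x y → h (x + y) ≈ h x + h y

  *-isAdditive : ∀ w → IsAdditive (w *_)
  *-isAdditive w = record { h-cong = *-congˡ ; h-0 = zeroʳ w ; h-+ = distribˡ w }

  -‿isAdditive : IsAdditive (λ x → - x)
  -‿isAdditive = record
    { h-cong = -‿cong ; h-0 = ε⁻¹≈ε ; h-+ = λ x y → sym (⁻¹-∙-comm x y) }

  sum-cong : {f g : Fin n → Carrier} → (∀ i → f i ≈ g i) → sum f ≈ sum g
  sum-cong = sum-cong-≋

  sum-zero : {f : Fin n → Carrier} → (∀ i → f i ≈ 0#) → sum f ≈ 0#
  sum-zero {n} f≈0 = trans (sum-cong f≈0) (sum-replicate-zero n)

  sum-additive : ∀ {h} → IsAdditive h → (f : Fin n → Carrier) →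
                 h (sum f) ≈ sum (λ i → h (f i))
  sum-additive {zero}  H f = IsAdditive.h-0 H
  sum-additive {suc n} H f =
    trans (IsAdditive.h-+ H _ _) (+-congˡ (sum-additive H (f ∘ suc)))

  ⊠-zero : ∀ n {x} → x ≈ 0# → n ⊠ x ≈ 0#
  ⊠-zero zero    x≈0 = refl
  ⊠-zero (suc n) x≈0 = trans (+-cong x≈0 (⊠-zero n x≈0)) (+-identityˡ 0#)

  -- The same expression as the entries of the identity of `matrixRawRing`, so that a zeroth matrix
  -- power reduces to `δ`.
  δ : Fin n → Fin n → Carrier
  δ i j = if does (i ≟ j) then 1# else 0#

  δ-refl : (i : Fin n) → δ i i ≈ 1#
  δ-refl i with i ≟ i
  ... | yes _  = refl
  ... | no i≢i = contradiction ≡.refl i≢i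

  δ-≢ : {i j : Fin n} → i ≢ j → δ i j ≈ 0#
  δ-≢ {i = i} {j} i≢j with i ≟ j
  ... | yes i≡j = contradiction i≡j i≢j
  ... | no _    = refl

  sum-δ : (i : Fin n) (f : Fin n → Carrier) → sum (λ k → δ i k * f k) ≈ f i
  sum-δ zero f = begin
    1# * f zero + sum (λ k → 0# * f (suc k))  ≈⟨ +-cong (*-identityˡ _) (sum-zero {f = λ k → 0# * f (suc k)} λ _ → zeroˡ _) ⟩
    f zero + 0#                               ≈⟨ +-identityʳ _ ⟩
    f zero                                    ∎
  sum-δ (suc i) f = begin
    0# * f zero + sum (λ k → δ i k * f (suc k))  ≈⟨ +-cong (zeroˡ _) (sum-δ i (f ∘ suc)) ⟩
    0# + f (suc i)                               ≈⟨ +-identityˡ _ ⟩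
    f (suc i)                                    ∎

  ∑ : List A → (A → Carrier) → Carrier
  ∑ xs f = foldr _+_ 0# (map f xs)

  ∑-cong : (xs : List A) {f g : A → Carrier} → (∀ x → f x ≈ g x) → ∑ xs f ≈ ∑ xs g
  ∑-cong []       f≈g = refl
  ∑-cong (x ∷ xs) f≈g = +-cong (f≈g x) (∑-cong xs f≈g)

  ∑-zero : (xs : List A) {f : A → Carrier} → (∀ x → f x ≈ 0#) → ∑ xs f ≈ 0#
  ∑-zero []       f≈0 = refl
  ∑-zero (x ∷ xs) f≈0 = trans (+-cong (f≈0 x) (∑-zero xs f≈0)) (+-identityˡ 0#)

  ∑-additive : ∀ {h} → IsAdditive h → (xs : List A) (f : A → Carrier) →
               h (∑ xs f) ≈ ∑ xs (λ x → h (f x))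
  ∑-additive H []       f = IsAdditive.h-0 H
  ∑-additive H (x ∷ xs) f =
    trans (IsAdditive.h-+ H _ _) (+-congˡ (∑-additive H xs f))

  ∑-distribute-+ : (xs : List A) (f g : A → Carrier) →
                ∑ xs (λ x → f x + g x) ≈ ∑ xs f + ∑ xs g
  ∑-distribute-+ []       f g = sym (+-identityˡ 0#)
  ∑-distribute-+ (x ∷ xs) f g =
    trans (+-congˡ (∑-distribute-+ xs f g)) (interchange _ _ _ _)

  ∑-swap : (xs : List A) (ys : List B) (f : A → B → Carrier) →
           ∑ xs (λ x → ∑ ys (f x)) ≈ ∑ ys (λ y → ∑ xs λ x → f x y)
  ∑-swap []       ys f = sym (∑-zero ys λ _ → refl)
  ∑-swap (x ∷ xs) ys f =
    trans (+-congˡ (∑-swap xs ys f)) (sym (∑-distribute-+ ys (f x) _))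

  ∑-++ : (xs ys : List A) (f : A → Carrier) → ∑ (xs ++ ys) f ≈ ∑ xs f + ∑ ys f
  ∑-++ []       ys f = sym (+-identityˡ _)
  ∑-++ (x ∷ xs) ys f = trans (+-congˡ (∑-++ xs ys f)) (sym (+-assoc _ _ _))

  ∑-map : (g : A → B) (xs : List A) (f : B → Carrier) → ∑ (map g xs) f ≈ ∑ xs (f ∘ g)
  ∑-map g []       f = refl
  ∑-map g (x ∷ xs) f = +-congˡ (∑-map g xs f)

  ∑-cartesianProductWith :
    {C : Set p} (g : A → B → C) (xs : List A) (ys : List B) (f : C → Carrier) →
    ∑ (cartesianProductWith g xs ys) f ≈ ∑ xs (λ x → ∑ ys λ y → f (g x y))
  ∑-cartesianProductWith g []       ys f = refl
  ∑-cartesianProductWith g (x ∷ xs) ys f =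
    trans (∑-++ (map (g x) ys) _ f)
          (+-cong (∑-map (g x) ys f) (∑-cartesianProductWith g xs ys f))

  -- Extension by zero: this turns sums over nonempty subsets or simple paths into sums over all
  -- subsets or all vectors of pairs.
  ∑-filter : {P : Pred A p} (P? : Decidable P) (xs : List A) {f g : A → Carrier} →
             (∀ {x} → P x → f x ≈ g x) → (∀ {x} → ¬ P x → g x ≈ 0#) →
             ∑ (filter P? xs) f ≈ ∑ xs g
  ∑-filter P? []       f≈g g≈0 = refl
  ∑-filter P? (x ∷ xs) f≈g g≈0 with P? x
  ... | yes Px = +-cong (f≈g Px) (∑-filter P? xs f≈g g≈0)
  ... | no ¬Px = trans (sym (+-identityˡ _))
                       (+-cong (sym (g≈0 ¬Px)) (∑-filter P? xs f≈g g≈0))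

  ∑-tabulate : (g : Fin n → A) (f : A → Carrier) → ∑ (tabulate g) f ≈ sum (f ∘ g)
  ∑-tabulate {zero}  g f = refl
  ∑-tabulate {suc n} g f = +-congˡ (∑-tabulate (g ∘ suc) f)

  -- Sums over subsets.

  subsets : ∀ n → List (Subset n)
  subsets = vectors (inside ∷ outside ∷ [])

  ∑-subsets-suc : (f : Subset (suc n) → Carrier) →
                  ∑ (subsets (suc n)) f ≈
                  ∑ (subsets n) (f ∘ (inside ∷_)) + ∑ (subsets n) (f ∘ (outside ∷_))
  ∑-subsets-suc {n} f =
    trans (∑-cartesianProductWith _∷_ (inside ∷ outside ∷ []) (subsets n) f)
          (+-congˡ (+-identityʳ _))

  -- Induction over the vertices, with `r` and `s` counting those already decided to lie inside and
  -- outside `S`. A vertex of `T` has to go inside, the other branch being zero; any other vertex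
  -- may go either way, and `pascal` merges the two branches. Positivity of `r + ∣ T ∣` is carried
  -- along because for the exponent `k ∸ 1` the Pascal rule is available only at positive `k`.
  ∑-supersets :
    (g : ℕ → ℕ → Carrier) →
    (∀ {r} s → 0 < r → g (suc r) s + g r (suc s) ≈ g r s) →
    ∀ r s (T : Subset n) → 0 < r ℕ.+ ∣ T ∣ → (f : Subset n → Carrier) →
    (∀ {S} → T ⊆ S → f S ≈ g (r ℕ.+ ∣ S ∣) (s ℕ.+ (n ∸ ∣ S ∣))) →
    (∀ {S} → ¬ T ⊆ S → f S ≈ 0#) →
    ∑ (subsets n) f ≈ g (r ℕ.+ ∣ T ∣) s
  ∑-supersets g pascal r s [] pos f f≈g f≈0 = begin
    f [] + 0#                ≈⟨ +-identityʳ _ ⟩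
    f []                     ≈⟨ f≈g id ⟩
    g (r ℕ.+ 0) (s ℕ.+ 0)    ≡⟨ ≡.cong (g (r ℕ.+ 0)) (ℕ.+-identityʳ s) ⟩
    g (r ℕ.+ 0) s            ∎
  ∑-supersets {suc n} g pascal r s (inside ∷ T) pos f f≈g f≈0 = begin
    ∑ (subsets (suc n)) f
      ≈⟨ ∑-subsets-suc f ⟩
    ∑ (subsets n) (f ∘ (inside ∷_)) + ∑ (subsets n) (f ∘ (outside ∷_))
      ≈⟨ +-cong
           (∑-supersets g pascal (suc r) s T (s≤s z≤n) _
              (λ {S} T⊆S → trans (f≈g (λ { here → here ; (there i) → there (T⊆S i) }))
                 (reflexive (≡.cong (λ q → g q (s ℕ.+ (n ∸ ∣ S ∣))) (ℕ.+-suc r ∣ S ∣))))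
              (λ T⊈S → f≈0 (T⊈S ∘ drop-∷-⊆)))
           (∑-zero (subsets n) λ S → f≈0 λ i⊆o → contradiction (i⊆o here) λ ()) ⟩
    g (suc r ℕ.+ ∣ T ∣) s + 0#
      ≈⟨ +-identityʳ _ ⟩
    g (suc r ℕ.+ ∣ T ∣) s
      ≡⟨ ≡.cong (λ q → g q s) (≡.sym (ℕ.+-suc r ∣ T ∣)) ⟩
    g (r ℕ.+ suc ∣ T ∣) s ∎
  ∑-supersets {suc n} g pascal r s (outside ∷ T) pos f f≈g f≈0 = begin
    ∑ (subsets (suc n)) f
      ≈⟨ ∑-subsets-suc f ⟩
    ∑ (subsets n) (f ∘ (inside ∷_)) + ∑ (subsets n) (f ∘ (outside ∷_))
      ≈⟨ +-cong
           (∑-supersets g pascal (suc r) s T (s≤s z≤n) _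
              (λ {S} T⊆S → trans (f≈g (λ { (there i) → there (T⊆S i) }))
                 (reflexive (≡.cong (λ q → g q (s ℕ.+ (n ∸ ∣ S ∣))) (ℕ.+-suc r ∣ S ∣))))
              (λ T⊈S → f≈0 (T⊈S ∘ drop-∷-⊆)))
           (∑-supersets g pascal r (suc s) T pos _
              (λ {S} T⊆S → trans (f≈g (λ { (there i) → there (T⊆S i) }))
                 (reflexive (≡.cong (g _)
                   -- `∣ S ∣ ≤ n` keeps the truncated subtraction exact: the new outside vertex
                   -- raises `n ∸ ∣ S ∣` by one.
                   (≡.trans (≡.cong (s ℕ.+_) (ℕ.+-∸-assoc 1 (∣p∣≤n S)))
                            (ℕ.+-suc s _)))))
              (λ T⊈S → f≈0 (T⊈S ∘ drop-∷-⊆))) ⟩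
    g (suc r ℕ.+ ∣ T ∣) s + g (r ℕ.+ ∣ T ∣) (suc s)
      ≈⟨ pascal s pos ⟩
    g (r ℕ.+ ∣ T ∣) s ∎

  ifEmpty ifSingleton : Carrier → ℕ → Carrier
  ifEmpty x 0       = x
  ifEmpty x (suc _) = 0#
  ifSingleton x 0       = 0#
  ifSingleton x (suc k) = ifEmpty x k

  ∑-ifEmpty : ∀ n x → ∑ (subsets n) (λ S → ifEmpty x ∣ S ∣) ≈ x
  ∑-ifEmpty zero    x = +-identityʳ x
  ∑-ifEmpty (suc n) x = begin
    ∑ (subsets (suc n)) (λ S → ifEmpty x ∣ S ∣)
      ≈⟨ ∑-subsets-suc {n} (λ S → ifEmpty x ∣ S ∣) ⟩
    ∑ (subsets n) (λ _ → 0#) + ∑ (subsets n) (λ S → ifEmpty x ∣ S ∣)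
      ≈⟨ +-cong (∑-zero (subsets n) λ _ → refl) (∑-ifEmpty n x) ⟩
    0# + x
      ≈⟨ +-identityˡ x ⟩
    x ∎

  -- A singleton either contains the first vertex and is empty elsewhere, or avoids that vertex;
  -- this matches the unfolding of `suc n ⊠ x`. The count yields the constant term of the sum in
  -- (i).
  ∑-ifSingleton : ∀ n x → ∑ (subsets n) (λ S → ifSingleton x ∣ S ∣) ≈ n ⊠ x
  ∑-ifSingleton zero    x = +-identityʳ 0#
  ∑-ifSingleton (suc n) x =
    trans (∑-subsets-suc {n} (λ S → ifSingleton x ∣ S ∣))
          (+-cong (∑-ifEmpty n x) (∑-ifSingleton n x))

  -- Coefficients of `z^r (1 - z)^s`.

  -- [z^d] z^r (1 - z)^s, as an additive operator on R.
  coeff : ℕ → ℕ → ℕ → Carrier → Carrier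
  coeff zero    zero    zero    x = x
  coeff zero    zero    (suc d) x = 0#
  coeff zero    (suc s) zero    x = coeff zero s zero x
  coeff zero    (suc s) (suc d) x = coeff zero s (suc d) x + - coeff zero s d x
  coeff (suc r) s       zero    x = 0#
  coeff (suc r) s       (suc d) x = coeff r s d x

  open IsAdditive

  coeff-isAdditive : ∀ r s d → IsAdditive (coeff r s d)
  coeff-isAdditive zero zero zero = record
    { h-cong = id ; h-0 = refl ; h-+ = λ _ _ → refl }
  coeff-isAdditive zero zero (suc d) = record
    { h-cong = λ _ → refl ; h-0 = refl ; h-+ = λ _ _ → sym (+-identityˡ 0#) }
  coeff-isAdditive zero (suc s) zero = coeff-isAdditive zero s zero
  coeff-isAdditive zero (suc s) (suc d) = record
    { h-cong = λ x≈y → +-cong (h-cong F x≈y) (-‿cong (h-cong G x≈y))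
    ; h-0    = trans (+-cong (h-0 F) (trans (-‿cong (h-0 G)) ε⁻¹≈ε)) (+-identityˡ 0#)
    ; h-+    = λ x y →
        trans (+-cong (h-+ F x y) (trans (-‿cong (h-+ G x y)) (sym (⁻¹-∙-comm _ _))))
              (interchange _ _ _ _)
    }
    where
    F = coeff-isAdditive zero s (suc d)
    G = coeff-isAdditive zero s d
  coeff-isAdditive (suc r) s zero = record
    { h-cong = λ _ → refl ; h-0 = refl ; h-+ = λ _ _ → sym (+-identityˡ 0#) }
  coeff-isAdditive (suc r) s (suc d) = coeff-isAdditive r s d

  -- The coefficients of `z^r (1 - z)^s` are integers, hence central even when the labels do not
  -- commute.
  coeff-*ˡ : ∀ r s d w x → w * coeff r s d x ≈ coeff r s d (w * x)
  coeff-*ˡ zero    zero    zero    w x = refl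
  coeff-*ˡ zero    zero    (suc d) w x = zeroʳ w
  coeff-*ˡ zero    (suc s) zero    w x = coeff-*ˡ zero s zero w x
  coeff-*ˡ zero    (suc s) (suc d) w x =
    trans (x[y-z]≈xy-xz w _ _)
          (+-cong (coeff-*ˡ zero s (suc d) w x) (-‿cong (coeff-*ˡ zero s d w x)))
  coeff-*ˡ (suc r) s       zero    w x = zeroʳ w
  coeff-*ˡ (suc r) s       (suc d) w x = coeff-*ˡ r s d w x

  coeff-∑-*ˡ : ∀ r s d (w x : Fin n → Carrier) →
               sum (λ k → w k * coeff r s d (x k)) ≈ coeff r s d (sum λ k → w k * x k)
  coeff-∑-*ˡ r s d w x =
    trans (sum-cong λ k → coeff-*ˡ r s d (w k) (x k))
          (sym (sum-additive (coeff-isAdditive r s d) λ k → w k * x k))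

  -- This is `z + (1 - z) = 1` times `z^r (1 - z)^s`. For `r = 0` in positive degree, the shifted
  -- term `coeff 1 s (suc d)` is precisely the one subtracted in `coeff 0 (suc s) (suc d)`; a
  -- positive `r` only shifts the degree.
  coeff-pascal : ∀ r s d x → coeff (suc r) s d x + coeff r (suc s) d x ≈ coeff r s d x
  coeff-pascal zero    s zero    x = +-identityˡ _
  coeff-pascal zero    s (suc d) x = trans (+-comm _ _) (//-rightDividesˡ _ _)
  coeff-pascal (suc r) s zero    x = +-identityˡ 0#
  coeff-pascal (suc r) s (suc d) x = coeff-pascal r s d x

  coeff-diag : ∀ d x → coeff d 0 d x ≈ x
  coeff-diag zero    x = refl
  coeff-diag (suc d) x = coeff-diag d x

  coeff-off-diag : ∀ {r d} → d ≢ r → ∀ x → coeff r 0 d x ≈ 0#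
  coeff-off-diag {zero}  {zero}  d≢r x = contradiction ≡.refl d≢r
  coeff-off-diag {zero}  {suc d} d≢r x = refl
  coeff-off-diag {suc r} {zero}  d≢r x = refl
  coeff-off-diag {suc r} {suc d} d≢r x = coeff-off-diag (d≢r ∘ ≡.cong suc) x

  coeff-const : ∀ s x → coeff 0 s 0 x ≈ x
  coeff-const zero    x = refl
  coeff-const (suc s) x = coeff-const s x

-- Coefficients of products of matrices over power series.

module SeriesMatrices {c ℓ} (R : Ring c ℓ) (N : ℕ) where
  open Ring R hiding (zero)
  open RingProperties R using (-‿distribˡ-*; -0#≈0#)
  open RingSums R
  open import Algebra.Properties.Monoid.Mult +-monoid using () renaming (_×_ to _⊠_)
  open import Relation.Binary.Reasoning.Setoid setoid

  private
    module Series = RawRing (seriesRawRing rawRing)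
    module Matrices = RawRing (matrixRawRing (seriesRawRing rawRing) N)
    open RawSemiringDefs Matrices.rawSemiring using (_^_) renaming (_×_ to _⊠ᴹ_)
    open RawSemiringDefs (RawRing.rawSemiring (matrixRawRing rawRing N)) using ()
      renaming (_^_ to _^ᴿ_)
    _⊛_ = Series._*_
    _⊡_ = Matrices._*_
    I = Matrices.1#

  -- Addition of series is pointwise by definition; the induction only unfolds the iterated sum.
  sum-at : (f : Fin n → Series.Carrier) (d : ℕ) →
           RawSemiringDefs.sum Series.rawSemiring f d ≡ sum (λ k → f k d)
  sum-at {zero}  f d = ≡.refl
  sum-at {suc n} f d = ≡.cong (f zero d +_) (sum-at (f ∘ suc) d)

  ∑-at : (xs : List A) (F : A → Matrices.Carrier) → ∀ i j d →
         foldr Matrices._+_ Matrices.0# (map F xs) i j d ≡ ∑ xs (λ x → F x i j d)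
  ∑-at []       F i j d = ≡.refl
  ∑-at (x ∷ xs) F i j d = ≡.cong (F x i j d +_) (∑-at xs F i j d)

  ⊠-at : ∀ n M i j d → (n ⊠ᴹ M) i j d ≡ n ⊠ M i j d
  ⊠-at zero    M i j d = ≡.refl
  ⊠-at (suc n) M i j d = ≡.cong (M i j d +_) (⊠-at n M i j d)

  -- The series `u + w z`. The entries of `zW S` and `I - zW S` have this form, so such a left
  -- factor contributes only two terms to a Cauchy product.
  IsAffine : Series.Carrier → Carrier → Carrier → Set ℓ
  IsAffine f u w = f 0 ≈ u × f 1 ≈ w × (∀ m → f (suc (suc m)) ≈ 0#)

  affine-*-zero : ∀ f {u w} → IsAffine f u w → ∀ g → (f ⊛ g) 0 ≈ u * g 0
  affine-*-zero f (f₀ , _ , _) g = trans (+-identityʳ _) (*-congʳ f₀)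

  affine-*-suc : ∀ f {u w} → IsAffine f u w → ∀ g d →
                 (f ⊛ g) (suc d) ≈ u * g (suc d) + w * g d
  affine-*-suc f (f₀ , f₁ , f₂) g d = +-cong (*-congʳ f₀)
    (trans (+-cong (*-congʳ f₁) (sum-zero {d} λ k → trans (*-congʳ (f₂ (toℕ k))) (zeroˡ (g (d ∸ suc (toℕ k))))))
           (+-identityʳ _))

  Coefficients : Set c
  Coefficients = Fin N → Fin N → Carrier

  IsAffineMatrix : Matrices.Carrier → Coefficients → Coefficients → Set ℓ
  IsAffineMatrix A U W = ∀ i j → IsAffine (A i j) (U i j) (W i j)

  module _ (A : Matrices.Carrier) {U W : Coefficients} (aff : IsAffineMatrix A U W) where

    affineMatrix-*-zero : ∀ F i j → (A ⊡ F) i j 0 ≈ sum λ k → U i k * F k j 0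
    affineMatrix-*-zero F i j =
      trans (reflexive (sum-at (λ k → A i k ⊛ F k j) 0))
            (sum-cong {N} λ k → affine-*-zero (A i k) (aff i k) (F k j))

    affineMatrix-*-suc : ∀ F i j d →
      (A ⊡ F) i j (suc d) ≈ sum (λ k → U i k * F k j (suc d)) + sum (λ k → W i k * F k j d)
    affineMatrix-*-suc F i j d =
      trans (reflexive (sum-at (λ k → A i k ⊛ F k j) (suc d)))
     (trans (sum-cong {N} λ k → affine-*-suc (A i k) (aff i k) (F k j) d)
            (∑-distrib-+ {N} (λ k → U i k * F k j (suc d)) (λ k → W i k * F k j d)))

  I-affine : IsAffineMatrix I δ (λ _ _ → 0#)
  I-affine i j with i ≟ j
  ... | yes _ = refl , refl , λ _ → refl
  ... | no _  = refl , refl , λ _ → refl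

  I-at-suc : ∀ i j d → I i j (suc d) ≈ 0#
  I-at-suc i j zero    = proj₁ (proj₂ (I-affine i j))
  I-at-suc i j (suc d) = proj₂ (proj₂ (I-affine i j)) d

  *-identityˡ-at : ∀ F i j d → (I ⊡ F) i j d ≈ F i j d
  *-identityˡ-at F i j zero =
    trans (affineMatrix-*-zero I I-affine F i j) (sum-δ i λ k → F k j 0)
  *-identityˡ-at F i j (suc d) =
    trans (affineMatrix-*-suc I I-affine F i j d)
   (trans (+-cong (sum-δ i λ k → F k j (suc d)) (sum-zero {N} λ k → zeroˡ (F k j d))) (+-identityʳ _))

  module _ (Z : Matrices.Carrier) (W : Coefficients)
           (Z-affine : IsAffineMatrix Z (λ _ _ → 0#) W) where

    Z-*-zero : ∀ F i j → (Z ⊡ F) i j 0 ≈ 0#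
    Z-*-zero F i j =
      trans (affineMatrix-*-zero Z Z-affine F i j) (sum-zero {N} λ k → zeroˡ (F k j 0))

    Z-*-suc : ∀ F i j d → (Z ⊡ F) i j (suc d) ≈ sum λ k → W i k * F k j d
    Z-*-suc F i j d =
      trans (affineMatrix-*-suc Z Z-affine F i j d)
     (trans (+-congʳ (sum-zero {N} λ k → zeroˡ (F k j (suc d)))) (+-identityˡ _))

    Z-*-assoc-zero : ∀ X F i j → ((Z ⊡ X) ⊡ F) i j 0 ≈ 0#
    Z-*-assoc-zero X F i j =
      trans (reflexive (sum-at (λ k → (Z ⊡ X) i k ⊛ F k j) 0))
            (sum-zero {N} λ k → trans (+-identityʳ _)
              (trans (*-congʳ (Z-*-zero X i k)) (zeroˡ (F k j 0))))

    -- The instance of `(Z X) F = Z (X F)` that is used, checked coefficientwise. Since `Z ^ suc r`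
    -- unfolds to `Z ⊡ (Z ^ r)`, it lets the outer `Z` be split off the product with a power of
    -- `I-Z`.
    Z-*-assoc-suc : ∀ X F i j d →
      ((Z ⊡ X) ⊡ F) i j (suc d) ≈ sum λ l → W i l * (X ⊡ F) l j d
    Z-*-assoc-suc X F i j d = begin
      ((Z ⊡ X) ⊡ F) i j (suc d)
        ≡⟨ sum-at (λ k → (Z ⊡ X) i k ⊛ F k j) (suc d) ⟩
      sum (λ k → ((Z ⊡ X) i k ⊛ F k j) (suc d))
        -- `Z ⊡ X` has no constant term, so the convolution loses its first term and the others drop
        -- by one degree.
        ≈⟨ sum-cong {N} (λ k → trans
             (+-cong (trans (*-congʳ (Z-*-zero X i k)) (zeroˡ (F k j (suc d))))
                     (sum-cong {suc d} λ m → *-congʳ {F k j (d ∸ toℕ m)} (Z-*-suc X i k (toℕ m))))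
             (+-identityˡ _)) ⟩
      sum (λ k → sum {suc d} λ m → sum (λ l → W i l * X l k (toℕ m)) * F k j (d ∸ toℕ m))
        ≈⟨ sum-cong {N} (λ k → sum-cong {suc d} λ m → trans
             (*-distribʳ-sum (F k j (d ∸ toℕ m)) λ l → W i l * X l k (toℕ m))
             (sum-cong {N} λ l → *-assoc (W i l) (X l k (toℕ m)) (F k j (d ∸ toℕ m)))) ⟩
      sum (λ k → sum {suc d} λ m → sum λ l → W i l * (X l k (toℕ m) * F k j (d ∸ toℕ m)))
        -- Only the order of summation changes; the factors keep their order, so no commutativity of
        -- labels enters.
        ≈⟨ sum-cong {N} (λ k → trans (∑-comm {suc d} {N} λ m l → W i l * (X l k (toℕ m) * F k j (d ∸ toℕ m)))
             (sum-cong {N} λ l → sym (*-distribˡ-sum {suc d} (W i l)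
               λ m → X l k (toℕ m) * F k j (d ∸ toℕ m)))) ⟩
      sum (λ k → sum λ l → W i l * (X l k ⊛ F k j) d)
        ≈⟨ trans (∑-comm λ k l → W i l * (X l k ⊛ F k j) d)
             (sum-cong {N} λ l → sym (*-distribˡ-sum (W i l) λ k → (X l k ⊛ F k j) d)) ⟩
      sum (λ l → W i l * sum λ k → (X l k ⊛ F k j) d)
        ≈⟨ sum-cong {N} (λ l → *-congˡ (reflexive (≡.sym (sum-at (λ k → X l k ⊛ F k j) d)))) ⟩
      sum (λ l → W i l * (X ⊡ F) l j d) ∎

    I-Z : Matrices.Carrier
    I-Z = I Matrices.+ (Matrices.- Z)

    I-Z-affine : IsAffineMatrix I-Z δ (λ i j → - W i j)
    I-Z-affine i j =
      let I₀ , I₁ , I₂ = I-affine i j ; Z₀ , Z₁ , Z₂ = Z-affine i j in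
        trans (+-cong I₀ (trans (-‿cong Z₀) -0#≈0#)) (+-identityʳ _)
      , trans (+-cong I₁ (-‿cong Z₁)) (+-identityˡ _)
      , λ m → trans (+-cong (I₂ m) (trans (-‿cong (Z₂ m)) -0#≈0#)) (+-identityʳ _)

    -- Both sides obey the recursion coming from `(I - Z)^(s+1) = (I - Z)^s - Z (I - Z)^s`, where
    -- multiplying by `Z` raises the degree and the power of `W` together.
    I-Z-^ : ∀ s i j d → (I-Z ^ s) i j d ≈ coeff 0 s d ((W ^ᴿ d) i j)
    I-Z-^ zero    i j zero    = proj₁ (I-affine i j)
    I-Z-^ zero    i j (suc d) = I-at-suc i j d
    I-Z-^ (suc s) i j zero    = begin
      (I-Z ⊡ (I-Z ^ s)) i j 0            ≈⟨ affineMatrix-*-zero I-Z I-Z-affine (I-Z ^ s) i j ⟩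
      sum (λ k → δ i k * (I-Z ^ s) k j 0)  ≈⟨ sum-δ i (λ k → (I-Z ^ s) k j 0) ⟩
      (I-Z ^ s) i j 0                    ≈⟨ I-Z-^ s i j 0 ⟩
      coeff 0 s 0 (δ i j)                ∎
    I-Z-^ (suc s) i j (suc d) = begin
      (I-Z ⊡ (I-Z ^ s)) i j (suc d)
        ≈⟨ affineMatrix-*-suc I-Z I-Z-affine (I-Z ^ s) i j d ⟩
      sum (λ k → δ i k * (I-Z ^ s) k j (suc d)) + sum (λ k → - W i k * (I-Z ^ s) k j d)
        ≈⟨ +-cong (trans (sum-δ i (λ k → (I-Z ^ s) k j (suc d))) (I-Z-^ s i j (suc d)))
                  (sum-cong {N} λ k → trans (sym (-‿distribˡ-* (W i k) _))
                     (-‿cong (*-congˡ (I-Z-^ s k j d)))) ⟩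
      coeff 0 s (suc d) ((W ^ᴿ suc d) i j)
        + sum (λ k → - (W i k * coeff 0 s d ((W ^ᴿ d) k j)))
        ≈⟨ +-congˡ (trans (sym (sum-additive -‿isAdditive λ k → W i k * coeff 0 s d ((W ^ᴿ d) k j)))
             (-‿cong (coeff-∑-*ˡ 0 s d (W i) λ k → (W ^ᴿ d) k j))) ⟩
      coeff 0 (suc s) (suc d) ((W ^ᴿ suc d) i j) ∎

    -- As `Z = z W`, degree `d` in `z` is also degree `d` in `W`: the integer coefficient of
    -- `z^r (1 - z)^s` simply acts on `W ^ d`.
    Z-^-*-I-Z-^ : ∀ r s i j d →
                  ((Z ^ r) ⊡ (I-Z ^ s)) i j d ≈ coeff r s d ((W ^ᴿ d) i j)
    Z-^-*-I-Z-^ zero    s i j d       =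
      trans (*-identityˡ-at (I-Z ^ s) i j d) (I-Z-^ s i j d)
    Z-^-*-I-Z-^ (suc r) s i j zero    = Z-*-assoc-zero (Z ^ r) (I-Z ^ s) i j
    Z-^-*-I-Z-^ (suc r) s i j (suc d) =
      trans (Z-*-assoc-suc (Z ^ r) (I-Z ^ s) i j d)
     (trans (sum-cong {N} λ k → *-congˡ (Z-^-*-I-Z-^ r s k j d))
            (coeff-∑-*ˡ r s d (W i) λ k → (W ^ᴿ d) k j))

-- Powers of the restricted adjacency matrix as sums over walks.

module WalkExpansion {c ℓ e} (R : Ring c ℓ) {N : ℕ}
                     (G : LabeledDigraph (Ring.Carrier R) N e) where
  open Ring R hiding (zero)
  open RingProperties R using (-0#≈0#)
  open RingSums R
  open SeriesMatrices R N
  open LabeledDigraph G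
  open Paths G
  open import Algebra.Properties.Monoid.Mult +-monoid using (×-congʳ) renaming (_×_ to _⊠_)
  open import Relation.Binary.Reasoning.Setoid setoid
  open RawSemiringDefs (RawRing.rawSemiring (matrixRawRing rawRing N)) using ()
    renaming (_^_ to _^ᴿ_)

  private module GS = GeneratingSeries R G

  Wᵣ : Subset N → Fin N → Fin N → Carrier
  Wᵣ = restrict rawRing GS.W

  indeterminate-affine : IsAffine (indeterminate rawRing) 0# 1#
  indeterminate-affine = refl , refl , λ _ → refl

  zW-affine : ∀ S → IsAffineMatrix (GS.zW S) (λ _ _ → 0#) (Wᵣ S)
  zW-affine S i j =
      trans (affine-*-zero z indeterminate-affine w) (zeroˡ _)
    , trans (shift 0) (*-identityˡ _)
    , λ m → trans (shift (suc m)) (*-identityˡ _)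
    where
    z = indeterminate rawRing
    w = constant rawRing (Wᵣ S i j)
    shift : ∀ d → GS.zW S i j (suc d) ≈ 1# * w d
    shift d = trans (affine-*-suc z indeterminate-affine w d)
                    (trans (+-congʳ (zeroˡ (w (suc d)))) (+-identityˡ _))

  -- Defined on all vectors of pairs, the same index set from which `simplePaths` is filtered. The
  -- factors `δ` enforce contiguity and the two ends, and zero entries of `Wᵣ S` discard non-arcs
  -- and pairs leaving `S`.
  walkWeight : ∀ {l} → Subset N → Fin N → Fin N → Vec Pair l → Carrier
  walkWeight S i j []            = δ i j
  walkWeight S i j ((a , b) ∷ p) = δ i a * (Wᵣ S a b * walkWeight S b j p)

  ∑-pairs : (f : Pair → Carrier) → ∑ pairs f ≈ sum λ a → sum λ b → f (a , b)
  ∑-pairs f =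
    trans (∑-cartesianProductWith _,_ (allFin N) (allFin N) f)
   (trans (∑-tabulate id λ a → ∑ (allFin N) λ b → f (a , b))
          (sum-cong λ a → ∑-tabulate id λ b → f (a , b)))

  ^-expansion : ∀ S d i j → (Wᵣ S ^ᴿ d) i j ≈ ∑ (vectors pairs d) (walkWeight S i j)
  ^-expansion S zero    i j = sym (+-identityʳ _)
  ^-expansion S (suc d) i j = sym (begin
    ∑ (vectors pairs (suc d)) (walkWeight S i j)
      ≈⟨ ∑-cartesianProductWith _∷_ pairs (vectors pairs d) (walkWeight S i j) ⟩
    ∑ pairs (λ x → ∑ (vectors pairs d) λ p → walkWeight S i j (x ∷ p))
      ≈⟨ ∑-pairs (λ x → ∑ (vectors pairs d) λ p → walkWeight S i j (x ∷ p)) ⟩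
    sum (λ a → sum λ b → ∑ (vectors pairs d) λ p → δ i a * (Wᵣ S a b * walkWeight S b j p))
      ≈⟨ sum-cong {N} (λ a → trans
           (sum-cong {N} λ b → sym (trans
              (*-congˡ (∑-additive (*-isAdditive (Wᵣ S a b)) (vectors pairs d) (walkWeight S b j)))
              (∑-additive (*-isAdditive (δ i a)) (vectors pairs d) λ p → Wᵣ S a b * walkWeight S b j p)))
           (sym (*-distribˡ-sum (δ i a) λ b → Wᵣ S a b * ∑ (vectors pairs d) (walkWeight S b j)))) ⟩
    sum (λ a → δ i a * sum λ b → Wᵣ S a b * ∑ (vectors pairs d) (walkWeight S b j))
      -- The factor `δ i a` forces the first pair to start at `i`.
      ≈⟨ sum-δ i (λ a → sum λ b → Wᵣ S a b * ∑ (vectors pairs d) (walkWeight S b j)) ⟩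
    sum (λ b → Wᵣ S i b * ∑ (vectors pairs d) (walkWeight S b j))
      ≈⟨ sum-cong {N} (λ b → *-congˡ (sym (^-expansion S d b j))) ⟩
    (Wᵣ S ^ᴿ suc d) i j ∎)

  -- Vertex sets and weights of walks.

  V-source : ∀ {l a b} {p : Vec Pair l} → a ∈ V ((a , b) ∷ p)
  V-source = x∈p∪q⁺ (inj₁ (x∈⁅x⁆ _))

  V-target : ∀ {l a b} {p : Vec Pair l} → b ∈ V ((a , b) ∷ p)
  V-target = x∈p∪q⁺ (inj₂ (x∈p∪q⁺ (inj₁ (x∈⁅x⁆ _))))

  V-tail : ∀ {l a b} {p : Vec Pair l} → V p ⊆ V ((a , b) ∷ p)
  V-tail x∈ = x∈p∪q⁺ (inj₂ (x∈p∪q⁺ (inj₂ x∈)))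

  V-∷-⊆ : ∀ {l a b} {p : Vec Pair l} {S} → a ∈ S → b ∈ S → V p ⊆ S → V ((a , b) ∷ p) ⊆ S
  V-∷-⊆ {a = a} {b} a∈S b∈S Vp⊆S x∈ with x∈p∪q⁻ ⁅ a ⁆ _ x∈
  ... | inj₁ x∈a rewrite x∈⁅y⁆⇒x≡y a x∈a = a∈S
  ... | inj₂ x∈′ with x∈p∪q⁻ ⁅ b ⁆ _ x∈′
  ...   | inj₁ x∈b rewrite x∈⁅y⁆⇒x≡y b x∈b = b∈S
  ...   | inj₂ x∈p = Vp⊆S x∈p

  Wᵣ-inside : ∀ {S a b} → a ∈ S → b ∈ S → Wᵣ S a b ≈ GS.W a b
  Wᵣ-inside {S} {a} {b} a∈S b∈S with a ∈? S | b ∈? S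
  ... | yes _  | yes _  = refl
  ... | yes _  | no b∉S = contradiction b∈S b∉S
  ... | no a∉S | _      = contradiction a∈S a∉S

  W-arc : ∀ {a b} → E a b → GS.W a b ≈ ω a b
  W-arc {a} {b} ab with E? a b
  ... | yes _  = refl
  ... | no ¬ab = contradiction ab ¬ab

  W-nonarc : ∀ {a b} → ¬ E a b → GS.W a b ≈ 0#
  W-nonarc {a} {b} ¬ab with E? a b
  ... | yes ab = contradiction ab ¬ab
  ... | no _   = refl

  xyz≈0ˡ : ∀ {x} → x ≈ 0# → ∀ y z → x * (y * z) ≈ 0#
  xyz≈0ˡ x≈0 y z = trans (*-congʳ x≈0) (zeroˡ _)

  xyz≈0ᵐ : ∀ {y} → y ≈ 0# → ∀ x z → x * (y * z) ≈ 0#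
  xyz≈0ᵐ y≈0 x z = trans (*-congˡ (trans (*-congʳ y≈0) (zeroˡ _))) (zeroʳ _)

  xyz≈0ʳ : ∀ {z} → z ≈ 0# → ∀ x y → x * (y * z) ≈ 0#
  xyz≈0ʳ z≈0 x y = trans (*-congˡ (trans (*-congˡ z≈0) (zeroʳ _))) (zeroʳ _)

  walkWeight-⊈ : ∀ {l} S i j (p : Vec Pair (suc l)) → ¬ V p ⊆ S → walkWeight S i j p ≈ 0#
  walkWeight-⊈ S i j ((a , b) ∷ p) V⊈S with a ∈? S | b ∈? S
  ... | no _  | _    = xyz≈0ᵐ refl _ _
  ... | yes _ | no _ = xyz≈0ᵐ refl _ _
  walkWeight-⊈ S i j ((a , b) ∷ []) V⊈S | yes a∈S | yes b∈S =
    ⊥-elim (V⊈S (V-∷-⊆ {p = []} a∈S b∈S (⊥-elim ∘ ∉⊥)))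
  walkWeight-⊈ S i j ((a , b) ∷ p@(_ ∷ _)) V⊈S | yes a∈S | yes b∈S =
    xyz≈0ʳ (walkWeight-⊈ S b j p λ Vp⊆S → V⊈S (V-∷-⊆ {p = p} a∈S b∈S Vp⊆S)) _ _

  -- With `⊤` as reference set the weight no longer depends on `S`, so that summing over `S`
  -- concerns the polynomial coefficients alone.
  walkWeight-⊆ : ∀ {l} S i j (p : Vec Pair l) → V p ⊆ S →
                 walkWeight S i j p ≈ walkWeight ⊤ i j p
  walkWeight-⊆ S i j []            V⊆S = refl
  walkWeight-⊆ S i j ((a , b) ∷ p) V⊆S = *-congˡ (*-cong
    (trans (Wᵣ-inside (V⊆S (V-source {p = p})) (V⊆S (V-target {p = p})))
           (sym (Wᵣ-inside ∈⊤ ∈⊤)))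
    (walkWeight-⊆ S b j p (V⊆S ∘ V-tail {p = p})))

  walkWeight-path : ∀ {l i j} {p : Vec Pair l} → IsPath i j p →
                    walkWeight ⊤ i j p ≈ GS.weight p
  walkWeight-path {i = i} {j} [ ij ] =
    trans (*-congʳ (δ-refl i)) (trans (*-identityˡ _)
      (*-cong (trans (Wᵣ-inside ∈⊤ ∈⊤) (W-arc ij)) (δ-refl j)))
  walkWeight-path {i = i} (ik ∷ kj) =
    trans (*-congʳ (δ-refl i)) (trans (*-identityˡ _)
      (*-cong (trans (Wᵣ-inside ∈⊤ ∈⊤) (W-arc ik)) (walkWeight-path kj)))

  -- Positive length matters: `[]` is not a path, yet its weight from `i` to `i` is `1#`.
  walkWeight-nonpath : ∀ {l} i j (p : Vec Pair (suc l)) → ¬ IsPath i j p →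
                       walkWeight ⊤ i j p ≈ 0#
  walkWeight-nonpath i j ((a , b) ∷ p) ¬path = byFirstArc p ¬path (i ≟ a) (E? a b)
    where
    byFirstArc : ∀ {l} (p : Vec Pair l) → ¬ IsPath i j ((a , b) ∷ p) →
                 Dec (i ≡ a) → Dec (E a b) → walkWeight ⊤ i j ((a , b) ∷ p) ≈ 0#
    byFirstArc p ¬path (no i≢a) _ = xyz≈0ˡ (δ-≢ i≢a) _ _
    byFirstArc p ¬path (yes _) (no ¬ab) =
      xyz≈0ᵐ (trans (Wᵣ-inside ∈⊤ ∈⊤) (W-nonarc ¬ab)) _ _
    byFirstArc [] ¬path (yes ≡.refl) (yes ab) =
      xyz≈0ʳ (δ-≢ {i = b} {j} λ { ≡.refl → ¬path [ ab ] }) _ _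
    byFirstArc p@(_ ∷ _) ¬path (yes ≡.refl) (yes ab) =
      xyz≈0ʳ (walkWeight-nonpath b j p λ path → ¬path (ab ∷ path)) _ _

  -- Number of vertices of a closed walk.

  sources : ∀ {l} → Vec Pair l → Subset N
  sources []            = ⊥
  sources ((a , b) ∷ p) = ⁅ a ⁆ ∪ sources p

  ∣sources∣≤length : ∀ {l} (p : Vec Pair l) → ∣ sources p ∣ ≤ l
  ∣sources∣≤length []            = ℕ.≤-reflexive (∣⊥∣≡0 N)
  ∣sources∣≤length ((a , b) ∷ p) =
    ℕ.≤-trans (∣p∪q∣≤∣p∣+∣q∣ ⁅ a ⁆ (sources p))
              (ℕ.+-mono-≤ (ℕ.≤-reflexive (∣⁅x⁆∣≡1 a)) (∣sources∣≤length p))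

  -- Every target except the last is the source of the next arc. `T` is arbitrary because the tail
  -- has fewer sources than the whole path, and `i ∈ T` is returned to serve as target of the
  -- preceding arc.
  path-V-⊆ : ∀ {l i j} {p : Vec Pair l} {T} → IsPath i j p → j ∈ T → sources p ⊆ T →
             i ∈ T × V p ⊆ T
  path-V-⊆ {i = i} [ ij ] j∈T src⊆T =
    i∈T , V-∷-⊆ {p = []} i∈T j∈T (⊥-elim ∘ ∉⊥)
    where i∈T = src⊆T (x∈p∪q⁺ (inj₁ (x∈⁅x⁆ i)))
  path-V-⊆ {i = i} (_∷_ {p = p} ik kj) j∈T src⊆T =
    let k∈T , Vp⊆T = path-V-⊆ kj j∈T (λ x∈ → src⊆T (x∈p∪q⁺ (inj₂ x∈))) in
    i∈T , V-∷-⊆ {p = p} i∈T k∈T Vp⊆T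
    where i∈T = src⊆T (x∈p∪q⁺ (inj₁ (x∈⁅x⁆ i)))

  -- On a closed walk the final vertex is also the first source, so `sources p` contains all of
  -- `V p`, with at most one source per arc.
  closed-∣V∣≤length : ∀ {l i} {p : Vec Pair l} → IsPath i i p → ∣ V p ∣ ≤ l
  closed-∣V∣≤length {i = i} {p} path =
    ℕ.≤-trans (p⊆q⇒∣p∣≤∣q∣ (proj₂ (path-V-⊆ path (i∈sources path) id)))
              (∣sources∣≤length p)
    where
    i∈sources : ∀ {l i j} {p : Vec Pair l} → IsPath i j p → i ∈ sources p
    i∈sources [ _ ]   = x∈p∪q⁺ (inj₁ (x∈⁅x⁆ _))
    i∈sources (_ ∷ _) = x∈p∪q⁺ (inj₁ (x∈⁅x⁆ _))

  V-nonempty : ∀ {l} (p : Vec Pair (suc l)) → Nonempty (V p)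
  V-nonempty ((a , _) ∷ p) = a , V-source {p = p}

  -- Summation over vertex sets.

  summand : (ℕ → ℕ) → Subset N → GS.Matrix
  summand α S = GS.zW S GS.^ α ∣ S ∣ GS.* (GS.I GS.- GS.zW S) GS.^ (N ∸ ∣ S ∣)

  summand-coeff : ∀ α S i j d →
    summand α S i j d ≈ coeff (α ∣ S ∣) (N ∸ ∣ S ∣) d ((Wᵣ S ^ᴿ d) i j)
  summand-coeff α S = Z-^-*-I-Z-^ (GS.zW S) (Wᵣ S) (zW-affine S) (α ∣ S ∣) (N ∸ ∣ S ∣)

  -- α is the exponent of z: k ∸ 1 in (i), k in (ii).
  module _ (α : ℕ → ℕ)
           (pascal : ∀ {r} s d x → 0 < r →
             coeff (α (suc r)) s d x + coeff (α r) (suc s) d x ≈ coeff (α r) s d x) where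

    -- The empty set contains no vertex of `p`, so it may be added to the range at no cost. The
    -- telescoping then starts with no vertex decided and leaves no factor `1 - z`.
    ∑-summand-walk : ∀ {l} i j (p : Vec Pair (suc l)) d →
      ∑ (nonemptySubsets N) (λ S → coeff (α ∣ S ∣) (N ∸ ∣ S ∣) d (walkWeight S i j p)) ≈
      coeff (α ∣ V p ∣) 0 d (walkWeight ⊤ i j p)
    ∑-summand-walk i j p d =
      trans (∑-filter nonempty? (subsets N) (λ _ → refl) λ {S} S-empty →
               vanishes S λ V⊆S → S-empty (_ , V⊆S (proj₂ (V-nonempty p))))
            (∑-supersets (λ r s → coeff (α r) s d (walkWeight ⊤ i j p))
               (λ s → pascal s d (walkWeight ⊤ i j p)) 0 0 (V p)
               (nonempty⇒∣p∣>0 (V-nonempty p)) _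
               (λ {S} V⊆S → IsAdditive.h-cong (coeff-isAdditive (α ∣ S ∣) (N ∸ ∣ S ∣) d)
                              (walkWeight-⊆ S i j p V⊆S))
               (λ {S} → vanishes S))
      where
      vanishes : ∀ S → ¬ V p ⊆ S →
                 coeff (α ∣ S ∣) (N ∸ ∣ S ∣) d (walkWeight S i j p) ≈ 0#
      vanishes S V⊈S = trans (IsAdditive.h-cong additive (walkWeight-⊈ S i j p V⊈S))
                             (IsAdditive.h-0 additive)
        where additive = coeff-isAdditive (α ∣ S ∣) (N ∸ ∣ S ∣) d

    ∑-summand : ∀ i j l →
      ∑ (nonemptySubsets N) (λ S → summand α S i j (suc l)) ≈
      ∑ (vectors pairs (suc l)) (λ p → coeff (α ∣ V p ∣) 0 (suc l) (walkWeight ⊤ i j p))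
    ∑-summand i j l = begin
      ∑ (nonemptySubsets N) (λ S → summand α S i j d)
        ≈⟨ ∑-cong (nonemptySubsets N) (λ S → trans (summand-coeff α S i j d)
             (trans (IsAdditive.h-cong (additive S) (^-expansion S d i j))
                    (∑-additive (additive S) (vectors pairs d) (walkWeight S i j)))) ⟩
      ∑ (nonemptySubsets N) (λ S → ∑ (vectors pairs d) λ p →
        coeff (α ∣ S ∣) (N ∸ ∣ S ∣) d (walkWeight S i j p))
        ≈⟨ ∑-swap (nonemptySubsets N) (vectors pairs d)
             (λ S p → coeff (α ∣ S ∣) (N ∸ ∣ S ∣) d (walkWeight S i j p)) ⟩
      ∑ (vectors pairs d) (λ p → ∑ (nonemptySubsets N) λ S →
        coeff (α ∣ S ∣) (N ∸ ∣ S ∣) d (walkWeight S i j p))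
        ≈⟨ ∑-cong (vectors pairs d) (λ p → ∑-summand-walk i j p d) ⟩
      ∑ (vectors pairs d) (λ p → coeff (α ∣ V p ∣) 0 d (walkWeight ⊤ i j p)) ∎
      where
      d = suc l
      additive : ∀ S → IsAdditive (coeff (α ∣ S ∣) (N ∸ ∣ S ∣) d)
      additive S = coeff-isAdditive (α ∣ S ∣) (N ∸ ∣ S ∣) d

    coeff-nonpath : ∀ {l} i j (p : Vec Pair (suc l)) r d → ¬ IsPath i j p →
                    coeff r 0 d (walkWeight ⊤ i j p) ≈ 0#
    coeff-nonpath i j p r d ¬path =
      trans (IsAdditive.h-cong additive (walkWeight-nonpath i j p ¬path))
            (IsAdditive.h-0 additive)
      where additive = coeff-isAdditive r 0 d

    -- The two hypotheses say that, among paths from `i` to `j`, the simple ones are those whose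
    -- length is the surviving exponent. They hold for `k ∸ 1` off the diagonal and for `k` on it.
    P-summand : ∀ i j l →
      (∀ {p : Vec Pair (suc l)} → IsSimplePath i j p → suc l ≡ α ∣ V p ∣) →
      (∀ {p : Vec Pair (suc l)} → IsPath i j p → suc l ≡ α ∣ V p ∣ → IsSimplePath i j p) →
      GS.P i j (suc l) ≈ ∑ (nonemptySubsets N) (λ S → summand α S i j (suc l))
    P-summand i j l simple⇒ ⇒simple =
      trans (∑-filter (isSimplePath? i j) (vectors pairs (suc l)) onSimple offSimple)
            (sym (∑-summand i j l))
      where
      onSimple : ∀ {p : Vec Pair (suc l)} → IsSimplePath i j p →
                 GS.weight p ≈ coeff (α ∣ V p ∣) 0 (suc l) (walkWeight ⊤ i j p)
      -- After the rewrite exponent and degree are both `suc l`, which reduces to `coeff l 0 l`.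
      onSimple {p} simple rewrite ≡.sym (simple⇒ simple) =
        sym (trans (coeff-diag l _) (walkWeight-path (proj₁ simple)))
      offSimple : ∀ {p : Vec Pair (suc l)} → ¬ IsSimplePath i j p →
                  coeff (α ∣ V p ∣) 0 (suc l) (walkWeight ⊤ i j p) ≈ 0#
      offSimple {p} ¬simple with isPath? i j p
      ... | no ¬path = coeff-nonpath i j p (α ∣ V p ∣) (suc l) ¬path
      ... | yes path = coeff-off-diag (¬simple ∘ ⇒simple path) _

    ∑-summand-zero : ∀ i j l →
      (∀ {p : Vec Pair (suc l)} → IsPath i j p → suc l ≢ α ∣ V p ∣) →
      ∑ (nonemptySubsets N) (λ S → summand α S i j (suc l)) ≈ 0#
    ∑-summand-zero i j l ≢α = trans (∑-summand i j l) (∑-zero (vectors pairs (suc l)) vanishes)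
      where
      vanishes : ∀ (p : Vec Pair (suc l)) →
                 coeff (α ∣ V p ∣) 0 (suc l) (walkWeight ⊤ i j p) ≈ 0#
      vanishes p with isPath? i j p
      ... | no ¬path = coeff-nonpath i j p (α ∣ V p ∣) (suc l) ¬path
      ... | yes path = coeff-off-diag (≢α path) _

  -- Comparison of coefficients on and off the diagonal.

  Diag-at-≡ : ∀ M i d → GS.Diag M i i d ≈ M i i d
  Diag-at-≡ M i d with i ≟ i
  ... | yes _  = refl
  ... | no i≢i = contradiction ≡.refl i≢i

  Diag-at-≢ : ∀ M {i j} d → i ≢ j → GS.Diag M i j d ≈ 0#
  Diag-at-≢ M {i} {j} d i≢j with i ≟ j
  ... | yes i≡j = contradiction i≡j i≢j
  ... | no _    = refl

  Pop-at-≡ : ∀ i d → GS.Pop i i d ≈ 0#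
  Pop-at-≡ i d = trans (+-congˡ (-‿cong (Diag-at-≡ GS.P i d))) (-‿inverseʳ _)

  Pop-at-≢ : ∀ {i j} d → i ≢ j → GS.Pop i j d ≈ GS.P i j d
  Pop-at-≢ d i≢j = trans (+-congˡ (trans (-‿cong (Diag-at-≢ GS.P d i≢j)) -0#≈0#)) (+-identityʳ _)

  -- The only vector of length zero is not a path, so `P i j 0` computes to `0#`.
  Pop-at-0 : ∀ i j → GS.Pop i j 0 ≈ 0#
  Pop-at-0 i j with i ≟ j
  ... | yes _ = -‿inverseʳ _
  ... | no _  = trans (+-congˡ -0#≈0#) (+-identityʳ _)

  0<∣V∣ : ∀ {l} (p : Vec Pair (suc l)) → 0 < ∣ V p ∣
  0<∣V∣ p = nonempty⇒∣p∣>0 (V-nonempty p)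

  -- At `r = 0` truncation would make all three exponents of `z` zero and the identity would fail in
  -- general.
  pascal-pred : ∀ {r} s d x → 0 < r →
    coeff (suc r ∸ 1) s d x + coeff (r ∸ 1) (suc s) d x ≈ coeff (r ∸ 1) s d x
  pascal-pred {suc r} s d x _ = coeff-pascal r s d x

  open-length : ∀ {i j l} → i ≢ j → {p : Vec Pair l} → IsSimplePath i j p → l ≡ ∣ V p ∣ ∸ 1
  open-length i≢j (_ , inj₁ (_ , l≡)) = l≡
  open-length i≢j (_ , inj₂ (i≡j , _)) = contradiction i≡j i≢j

  closed-length : ∀ {i l} {p : Vec Pair l} → IsSimplePath i i p → l ≡ ∣ V p ∣
  closed-length (_ , inj₁ (i≢i , _)) = contradiction ≡.refl i≢i
  closed-length (_ , inj₂ (_ , l≡))  = l≡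

  -- A closed walk has at most as many vertices as arcs, so `∣ V p ∣ ∸ 1` stays below its length.
  -- Hence every closed walk, simple or not, drops out of (i).
  closed-length-≢ : ∀ {i l} {p : Vec Pair (suc l)} → IsPath i i p → suc l ≢ ∣ V p ∣ ∸ 1
  closed-length-≢ {p = p} path l≡ with ∣ V p ∣ | closed-∣V∣≤length path | 0<∣V∣ p
  ... | suc v | v<l | _ = ℕ.<-irrefl (≡.sym l≡) v<l

  open-at-suc : ∀ i j l →
    GS.Pop i j (suc l) ≈ ∑ (nonemptySubsets N) (λ S → summand (_∸ 1) S i j (suc l))
  open-at-suc i j l = byEnds (i ≟ j)
    where
    byEnds : ∀ {j} → Dec (i ≡ j) → GS.Pop i j (suc l) ≈
             ∑ (nonemptySubsets N) (λ S → summand (_∸ 1) S i j (suc l))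
    byEnds (yes ≡.refl) = trans (Pop-at-≡ i (suc l))
      (sym (∑-summand-zero (_∸ 1) pascal-pred i i l closed-length-≢))
    byEnds {j} (no i≢j) = trans (Pop-at-≢ (suc l) i≢j)
      (P-summand (_∸ 1) pascal-pred i j l (open-length i≢j) λ path l≡ → path , inj₁ (i≢j , l≡))

  -- A constant term survives only if the exponent `∣ S ∣ ∸ 1` is zero. For nonempty `S` this means
  -- a singleton, and then both powers have constant term `I`.
  ∑-summand-const : ∀ i j →
    ∑ (nonemptySubsets N) (λ S → summand (_∸ 1) S i j 0) ≈ N ⊠ δ i j
  ∑-summand-const i j =
    trans (∑-filter nonempty? (subsets N)
             (λ {S} S-nonempty → trans (summand-coeff (_∸ 1) S i j 0)
               (onNonempty ∣ S ∣ (N ∸ ∣ S ∣) (nonempty⇒∣p∣>0 S-nonempty)))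
             (λ S-empty → offNonempty (Empty-unique S-empty)))
          (∑-ifSingleton N (δ i j))
    where
    onNonempty : ∀ k s → 0 < k → coeff (k ∸ 1) s 0 (δ i j) ≈ ifSingleton (δ i j) k
    onNonempty 1             s _ = coeff-const s (δ i j)
    onNonempty (suc (suc k)) s _ = refl
    offNonempty : ∀ {S : Subset N} → S ≡ ⊥ → ifSingleton (δ i j) ∣ S ∣ ≈ 0#
    offNonempty ≡.refl rewrite ∣⊥∣≡0 N = refl

  -- `Pop` has no constant term, whereas each of the `N` singletons contributes one `I` to the sum,
  -- through `zW S ^ 0`. Subtracting `N · I` cancels exactly this and leaves positive degrees
  -- unchanged.
  open-identity : GS.Pop GS.≈ (GS.∑𝒮 (summand (_∸ 1)) GS.- N GS.· GS.I)
  open-identity i j d = trans (core d) (sym (+-cong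
      (reflexive (∑-at (nonemptySubsets N) (summand (_∸ 1)) i j d))
      (-‿cong (reflexive (⊠-at N GS.I i j d)))))
    where
    core : ∀ d → GS.Pop i j d ≈
           ∑ (nonemptySubsets N) (λ S → summand (_∸ 1) S i j d) + - (N ⊠ GS.I i j d)
    core zero    = trans (Pop-at-0 i j) (sym (trans
      (+-cong (∑-summand-const i j) (-‿cong (×-congʳ N (proj₁ (I-affine i j)))))
      (-‿inverseʳ _)))
    core (suc l) = trans (open-at-suc i j l) (sym (trans
      (+-congˡ (trans (-‿cong (⊠-zero N (I-at-suc i j l))) -0#≈0#))
      (+-identityʳ _)))

  closed-identity : GS.Pcl GS.≈ GS.∑𝒮 (λ S → GS.Diag (summand id S))
  closed-identity i j d =
    trans (core d) (reflexive (≡.sym (∑-at (nonemptySubsets N) (GS.Diag ∘ summand id) i j d)))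
    where
    diagonal-core : ∀ d → GS.P i i d ≈ ∑ (nonemptySubsets N) (λ S → summand id S i i d)
    -- Every nonempty `S` carries a positive power of `zW S`, so (ii) needs no correction in degree
    -- zero.
    diagonal-core zero = sym
      (trans (∑-filter nonempty? (subsets N)
               (λ {S} S-nonempty → trans (summand-coeff id S i i 0)
                 (vanishes ∣ S ∣ (N ∸ ∣ S ∣) (nonempty⇒∣p∣>0 S-nonempty)))
               (λ _ → refl))
             (∑-zero (subsets N) λ _ → refl))
      where
      vanishes : ∀ k s → 0 < k → coeff k s 0 (δ i i) ≈ 0#
      vanishes (suc k) s _ = refl
    diagonal-core (suc l) =
      P-summand id (λ {r} s d x _ → coeff-pascal r s d x) i i l closed-length
        λ path l≡ → path , inj₂ (≡.refl , l≡)
    core : ∀ d → GS.Pcl i j d ≈ ∑ (nonemptySubsets N) (λ S → GS.Diag (summand id S) i j d)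
    core d = byEnds (i ≟ j)
      where
      byEnds : ∀ {j} → Dec (i ≡ j) →
               GS.Pcl i j d ≈ ∑ (nonemptySubsets N) (λ S → GS.Diag (summand id S) i j d)
      byEnds (yes ≡.refl) = trans (Diag-at-≡ GS.P i d) (trans (diagonal-core d)
        (∑-cong (nonemptySubsets N) λ S → sym (Diag-at-≡ (summand id S) i d)))
      byEnds (no i≢j) = trans (Diag-at-≢ GS.P d i≢j)
        (sym (∑-zero (nonemptySubsets N) λ S → Diag-at-≢ (summand id S) d i≢j))

proposition1 : ∀ {c ℓ e} (R : Ring c ℓ) {N : ℕ} (G : LabeledDigraph (Ring.Carrier R) N e) →
    let open GeneratingSeries R G in
    (Pop ≈ ∑𝒮 (λ S → zW S ^ (∣ S ∣ ∸ 1) * (I - zW S) ^ (N ∸ ∣ S ∣)) - N · I)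
    ×
    (Pcl ≈ ∑𝒮 (λ S → Diag (zW S ^ ∣ S ∣ * (I - zW S) ^ (N ∸ ∣ S ∣))))
proposition1 R G = open-identity , closed-identity
  where open WalkExpansion R G
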